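{- Reachability is undecidable for uniform PGTRS without variables and parameters. That is, there is no algorithm which, given a finite unranked alphabet $\Sigma$, an HA language $L\subseteq\mathcal{T}(\Sigma)$ (given by an HA), a finite set of rules $L::\ell\to r$ with $\ell,r$ ground hedges over $\Sigma$ (containing no variables and no automaton states), and two ground terms $t,t'\in\mathcal{T}(\Sigma)$, decides whether $t\to^* t'$ for the associated constrained rewrite relation.
   Context: Hedges and terms: for a finite alphabet $\Sigma$, ground hedges $\mathcal{H}(\Sigma)$ are finite (possibly empty) sequences of ground terms, and ground terms are $\mathcal{T}(\Sigma)=\{a(h): a\in\Sigma, h\in\mathcal{H}(\Sigma)\}$ ($a()$ written $a$); symbols are unranked. A context is a hedge containing one distinguished variable exactly once; $u[h]$ denotes replacing it by $h$. Hedge automata: an HA is $(\Sigma,Q,Q^{\mathsf f},\Delta)$ with finite state set $Q$, final states $Q^{\mathsf f}\subseteq Q$, and transitions $a(L')\to q$ with $a\in\Sigma$, $q\in Q$, $L'\subseteq Q^*$ regular; a ground hedge is accepted if it can be reduced to a final state by repeatedly replacing a subterm $a(q_1\dots q_n)$ with $q$ whenever $a(L')\to q$ is a transition and $q_1\dots q_n\in L'$. An HA language is the set of accepted hedges. PGTRS: a term rewriting system with global constraints is a finite set of constrained rules $L::\ell\to r$, where $L\subseteq\mathcal{T}(\Sigma)$ is an HA language and $\ell\to r$ is a (parametrized) rewrite rule. Its rewrite relation is restricted to ground terms: $t\to t'$ iff there is a rule $L::\ell\to r$ with $t\in L$ and $t\to t'$ by the ordinary rule $\ell\to r$ (for ground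 rules: $t=u[\ell]$ and $t'=u[r]$ for some context $u$). $\to^*$ is the reflexive-transitive closure. A PGTRS is uniform if the constraint language $L$ is the same for all its rules. Reachability asks, given $t,t'$, whether $t\to^* t'$. -}

module Defs where

open import Data.Nat using (ℕ; zero; suc; _*_; _^_; _≡ᵇ_)
open import Data.Bool using (if_then_else_)
open import Data.Fin using (Fin; toℕ)
open import Data.List using (List; []; _∷_; _++_)
open import Data.Maybe using (Maybe; just; nothing)
open import Data.Product using (Σ; ∃; _×_; _,_; proj₂)
open import Data.List.Membership.Propositional using (_∈_)
open import Data.List.Relation.Binary.Pointwise using (Pointwise)
open import Relation.Binary.Construct.Closure.ReflexiveTransitive using (Star)
open import Relation.Binary.PropositionalEquality using (_≡_)
open import Relation.Nullary using (¬_)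

data Term (n : ℕ) : Set where
  _⟨_⟩ : Fin n → List (Term n) → Term n

Hedge : ℕ → Set
Hedge n = List (Term n)

-- Hedge contexts: hedges containing exactly one occurrence of the variable.
--   hole l r       represents  l · x · r
--   deep l a C r   represents  l · a(C) · r
data Ctx (n : ℕ) : Set where
  hole : Hedge n → Hedge n → Ctx n
  deep : Hedge n → Fin n → Ctx n → Hedge n → Ctx n

plug : ∀ {n} → Ctx n → Hedge n → Hedge n
plug (hole l r) h     = l ++ h ++ r
plug (deep l a C r) h = l ++ (a ⟨ plug C h ⟩) ∷ r

record NFA (k : ℕ) : Set where
  field
    m       : ℕ
    initial : List (Fin m)
    final   : List (Fin m)
    δ       : List (Fin m × Fin k × Fin m)

data Path {k : ℕ} (A : NFA k) : Fin (NFA.m A) → List (Fin k) → Set where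
  done : ∀ {p} → p ∈ NFA.final A → Path A p []
  step : ∀ {p c p' w} → (p , c , p') ∈ NFA.δ A → Path A p' w → Path A p (c ∷ w)

NFAAccepts : ∀ {k} → NFA k → List (Fin k) → Set
NFAAccepts A w = ∃ λ p → p ∈ NFA.initial A × Path A p w

-- Hedge automata over Σ = Fin n: states Fin k, final states, transitions
-- a(L') → q with L' ⊆ (Fin k)* regular (given by an NFA).

record HA (n : ℕ) : Set where
  field
    k     : ℕ
    final : List (Fin k)
    Δ     : List (Fin n × NFA k × Fin k)

data Reduces {n : ℕ} (H : HA n) : Term n → Fin (HA.k H) → Set where
  node : ∀ {a ts q A qs} → (a , A , q) ∈ HA.Δ H →
         Pointwise (Reduces H) ts qs → NFAAccepts A qs →
         Reduces H (a ⟨ ts ⟩) q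

InLang : ∀ {n} → HA n → Term n → Set
InLang H t = ∃ λ q → q ∈ HA.final H × Reduces H t q

-- Instances of the problem: uniform PGTRS with ground rules (no variables,
-- no parameters), shared constraint language L, and two ground terms.

record Instance : Set where
  field
    n     : ℕ
    L     : HA n
    rules : List (Hedge n × Hedge n)
    src   : Term n
    tgt   : Term n

RStep : (I : Instance) → Term (Instance.n I) → Term (Instance.n I) → Set
RStep I t t' = Σ (Hedge (Instance.n I) × Hedge (Instance.n I)) λ { (ℓ , r) →
  ((ℓ , r) ∈ Instance.rules I) × InLang (Instance.L I) t ×
  (∃ λ u → plug u ℓ ≡ t ∷ [] × plug u r ≡ t' ∷ []) }

Reach : Instance → Set
Reach I = Star (RStep I) (Instance.src I) (Instance.tgt I)

-- Encoding of instances as natural numbers (injective pairing 2^a(2b+1))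

pair : ℕ → ℕ → ℕ
pair a b = 2 ^ a * suc (2 * b)

encList : ∀ {A : Set} → (A → ℕ) → List A → ℕ
encList e []       = 0
encList e (x ∷ xs) = suc (pair (e x) (encList e xs))

mutual
  encTerm : ∀ {n} → Term n → ℕ
  encTerm (a ⟨ ts ⟩) = pair (toℕ a) (encHedge ts)

  encHedge : ∀ {n} → Hedge n → ℕ
  encHedge []       = 0
  encHedge (t ∷ ts) = suc (pair (encTerm t) (encHedge ts))

encNFA : ∀ {k} → NFA k → ℕ
encNFA A = pair (NFA.m A) (pair (encList toℕ (NFA.initial A))
             (pair (encList toℕ (NFA.final A))
               (encList (λ { (p , c , p') → pair (toℕ p) (pair (toℕ c) (toℕ p')) }) (NFA.δ A))))

encHA : ∀ {n} → HA n → ℕ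
encHA H = pair (HA.k H) (pair (encList toℕ (HA.final H))
            (encList (λ { (a , A , q) → pair (toℕ a) (pair (encNFA A) (toℕ q)) }) (HA.Δ H)))

encInstance : Instance → ℕ
encInstance I = pair (Instance.n I) (pair (encHA (Instance.L I))
                  (pair (encList (λ { (ℓ , r) → pair (encHedge ℓ) (encHedge r) }) (Instance.rules I))
                    (pair (encTerm (Instance.src I)) (encTerm (Instance.tgt I)))))

-- Model of computation: register (Minsky) machines.
--   inc r      : increment register r, go to next instruction
--   decjz r j  : if register r is 0 jump to j, else decrement it and go on
-- The machine halts when the program counter leaves the program.
-- Input in register 0 (all others 0), output read from register 0.

data Instr : Set where
  inc   : ℕ → Instr
  decjz : ℕ → ℕ → Instr

Program : Set
Program = List Instr

nth : ∀ {A : Set} → List A → ℕ → Maybe A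
nth []       _       = nothing
nth (x ∷ xs) zero    = just x
nth (x ∷ xs) (suc i) = nth xs i

Regs : Set
Regs = ℕ → ℕ

update : Regs → ℕ → ℕ → Regs
update R r v i = if i ≡ᵇ r then v else R i

Config : Set
Config = ℕ × Regs

run : Program → ℕ → Config → Maybe Config
run P zero c = nothing
run P (suc f) (pc , R) with nth P pc
... | nothing          = just (pc , R)
... | just (inc r)     = run P f (suc pc , update R r (suc (R r)))
... | just (decjz r j) with R r
...   | zero  = run P f (j , R)
...   | suc v = run P f (suc pc , update R r v)

initRegs : ℕ → Regs
initRegs x i = if i ≡ᵇ 0 then x else 0

Computes : Program → ℕ → ℕ → Set
Computes P x y = ∃ λ fuel → ∃ λ c → run P fuel (0 , initRegs x) ≡ just c × proj₂ c 0 ≡ y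

DecidesReach : Program → Set
DecidesReach P = ∀ (I : Instance) →
  (Reach I → Computes P (encInstance I) 1) × (¬ Reach I → Computes P (encInstance I) 0)

{-# OPTIONS --safe #-}
module Submission where

-- A decision procedure P is refuted by an instance that runs P on its own code.
-- Flat terms are words, so ground rules on hedges are word rewriting rules, and a word
-- holding one control letter together with one letter per unit of each register is a
-- configuration of a counter machine. Increments and decrements are ground rules. The
-- machine tests for zero by entering a control state that forbids some registers: the
-- constraint language excludes the words violating this, so a wrong guess gets stuck.
-- The instance first computes its own code e from a number stored in its source term,
-- then simulates P on e, and reaches its target exactly when P outputs 0.

open import Defs
open import Data.Product using (Σ)
open import Relation.Nullary using (¬_)
open import Data.Bool using (if_then_else_)
open import Data.Empty using (⊥-elim)
open import Data.Fin using (Fin; zero; suc; toℕ; fromℕ<; _↑ˡ_; _↑ʳ_; splitAt)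
open import Data.Fin.Properties using (splitAt-↑ˡ; splitAt-↑ʳ; toℕ-fromℕ<; toℕ<n; toℕ-injective) renaming (_≟_ to _≟ᶠ_)
open import Data.List using (List; []; _∷_; [_]; _++_; map; replicate; length; lookup; filter; concatMap; fromMaybe; mapMaybe; allFin; cartesianProduct)
open import Data.List.Membership.Propositional using (_∈_; _∉_; find; lose)
open import Data.List.Membership.DecPropositional using (_∈?_)
open import Data.List.Membership.Propositional.Properties using (∈-map⁺; ∈-map⁻; ∈-++⁺ˡ; ∈-++⁺ʳ; ∈-++⁻; ∈-∃++; ∈-concatMap⁺; ∈-concatMap⁻; ∈-cartesianProduct⁺; ∈-filter⁺; ∈-filter⁻; ∈-allFin)
open import Data.List.Properties using (++-assoc; ∷-injectiveˡ; ++-identityʳ; map-++; mapMaybe-++)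
open import Data.List.Relation.Binary.Pointwise using (Pointwise; []; _∷_)
open import Data.List.Relation.Unary.All using (All; []; _∷_)
import Data.List.Relation.Unary.All as All
import Data.List.Relation.Unary.All.Properties as All
open import Data.List.Relation.Unary.Any using (here; there; index)
open import Data.List.Relation.Unary.Any.Properties using (lookup-index)
open import Data.Maybe using (Maybe; just; nothing)
open import Data.Maybe.Properties using (just-injective)
open import Data.Nat using (ℕ; zero; suc; _+_; _*_; _^_; _≤_; _<_; z≤n; s≤s; _∸_)
open import Data.Nat.ListAction using (sum)
open import Data.Nat.DivMod using (_mod_; m<n⇒m%n≡m)
open import Data.Nat.Properties using (+-commutativeSemigroup; +-identityʳ; +-assoc; +-comm; *-zeroʳ; +-cancelˡ-≡; _≟_; ≤-trans; ≤-reflexive; +-suc; +-mono-≤; +-monoʳ-≤; m≤m+n; m≤n+m; n≤1+n; m+n≡0⇒n≡0; 1+n≢0; ^-distribˡ-+-*; ^-*-assoc)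
open import Algebra.Properties.CommutativeSemigroup +-commutativeSemigroup using (x∙yz≈y∙xz)
open import Data.Nat.Tactic.RingSolver using (solve-∀)
open import Data.Product using (_×_; _,_; ∃₂; proj₁; proj₂)
open import Data.Sum using (inj₁; inj₂; [_,_]′)
open import Data.Unit using (⊤; tt)
open import Function using (_∘_)
open import Relation.Binary.Construct.Closure.ReflexiveTransitive using (Star; ε; _◅_; _◅◅_)
open import Relation.Binary.PropositionalEquality using (_≡_; refl; sym; trans; cong; cong₂; subst; module ≡-Reasoning)
open import Relation.Nullary using (Dec; yes; no; does; ¬?)
open import Relation.Nullary.Decidable using (map′; dec-true; dec-false)

-- Self-reference replaces a reduction from the halting problem. Such a reduction would need a
-- register program that computes codes of instances; here the rewrite rules do this arithmetic, and
-- no register program is ever written. The obstacle is that the rules must produce a code of which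
-- their own code is a part. The shape of `pair` removes it: the code of the rules enters the code
-- of the instance only through the factor 2 ^ (code of the rules). A source word of that length
-- supplies the factor itself, without any exponentiation, and its length also determines the code
-- of the source term. As a function of this length, the code of the instance is a constant, plus a
-- multiple of the length, plus a multiple of the length times one power. The exponent of that power
-- is an iterate of an affine map, because each further letter of a unary word acts on its code by
-- the same affine map. Adding, multiplying by constants and one exponentiation are therefore all
-- that has to be programmed with counters.

-- Counting letters in words

δ : ∀ {m} → Fin m → Fin m → ℕ
δ i j = if does (i ≟ᶠ j) then 1 else 0

count : ∀ {m} → Fin m → List (Fin m) → ℕ
count i []       = 0
count i (j ∷ js) = δ j i + count i js

count-++ : ∀ {m} (i : Fin m) xs ys → count i (xs ++ ys) ≡ count i xs + count i ys
count-++ i []       ys = refl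
count-++ i (x ∷ xs) ys rewrite count-++ i xs ys = sym (+-assoc (δ x i) _ _)

δ-refl : ∀ {m} (i : Fin m) → δ i i ≡ 1
δ-refl i with i ≟ᶠ i
... | yes _  = refl
... | no i≢i = ⊥-elim (i≢i refl)

δ-≢ : ∀ {m} {i j : Fin m} → ¬ (i ≡ j) → δ i j ≡ 0
δ-≢ {i = i} {j} i≢j with i ≟ᶠ j
... | yes i≡j = ⊥-elim (i≢j i≡j)
... | no  _   = refl

count-∉ : ∀ {m} {i : Fin m} xs → i ∉ xs → count i xs ≡ 0
count-∉ []       i∉ = refl
count-∉ (x ∷ xs) i∉ rewrite δ-≢ (i∉ ∘ here ∘ sym) = count-∉ xs (i∉ ∘ there)

count⇒∈ : ∀ {m} {i : Fin m} xs {k} → count i xs ≡ suc k → i ∈ xs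
count⇒∈ {i = i} (x ∷ xs) eq with x ≟ᶠ i
... | yes x≡i = here (sym x≡i)
... | no  _   = there (count⇒∈ xs eq)

∈⇒count≢0 : ∀ {m} {i : Fin m} {xs} → i ∈ xs → ¬ (count i xs ≡ 0)
∈⇒count≢0 {i = i} {_ ∷ xs} (here refl) e with () ← trans (cong (_+ count i xs) (sym (δ-refl i))) e
∈⇒count≢0 {i = i} {x ∷ xs} (there i∈)  e with δ x i
... | zero = ∈⇒count≢0 i∈ e

count≡0⇒[] : ∀ {m} (xs : List (Fin m)) → (∀ i → count i xs ≡ 0) → xs ≡ []
count≡0⇒[] []       _ = refl
count≡0⇒[] (x ∷ xs) h with () ← trans (cong (_+ count x xs) (sym (δ-refl x))) (h x)

spell : ∀ {m} → (Fin m → ℕ) → List (Fin m)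
spell {zero}  f = []
spell {suc m} f = replicate (f zero) zero ++ map suc (spell (f ∘ suc))

count-spell : ∀ {m} (f : Fin m → ℕ) i → count i (spell f) ≡ f i
count-spell {suc m} f i = trans (count-++ i (replicate (f zero) zero) _) (split i)
  where
  count-zeros : ∀ k → count zero (replicate k (zero {m})) ≡ k
  count-zeros zero    = refl
  count-zeros (suc k) = cong suc (count-zeros k)

  count-zeros-suc : ∀ j k → count (suc j) (replicate k (zero {m})) ≡ 0
  count-zeros-suc j zero    = refl
  count-zeros-suc j (suc k) = count-zeros-suc j k

  count-map-suc : ∀ xs → count zero (map (suc {m}) xs) ≡ 0
  count-map-suc []       = refl
  count-map-suc (x ∷ xs) = count-map-suc xs

  count-suc-map-suc : ∀ j xs → count (suc j) (map (suc {m}) xs) ≡ count j xs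
  count-suc-map-suc j []       = refl
  count-suc-map-suc j (x ∷ xs) = cong (δ x j +_) (count-suc-map-suc j xs)

  split : ∀ i → count i (replicate (f zero) zero) + count i (map suc (spell (f ∘ suc))) ≡ f i
  split zero    rewrite count-zeros (f zero) | count-map-suc (spell (f ∘ suc)) = +-identityʳ (f zero)
  split (suc j) rewrite count-zeros-suc j (f zero) = trans (count-suc-map-suc j (spell (f ∘ suc))) (count-spell (f ∘ suc) j)

-- Counter machines as ground rewriting under one constraint language

Counters : ℕ → Set
Counters m = Fin m → ℕ

-- A counter machine with m registers in which a control state q cannot be left
-- unless the registers in forbidden q are empty; this is how zero tests are made.
module Machine {State : Set} (states : List State) (listed : ∀ q → q ∈ states)
               {m : ℕ} (forbidden : State → List (Fin m)) (halt : State) where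

  data Letter : Set where
    root : Letter
    st   : State → Letter
    reg  : Fin m → Letter

  #letters : ℕ
  #letters = suc (m + length states)

  code : Letter → Fin #letters
  code root    = zero
  code (reg i) = suc (i ↑ˡ length states)
  code (st q)  = suc (m ↑ʳ index (listed q))

  state : Fin (length states) → State
  state = lookup states

  decode : Fin #letters → Letter
  decode zero    = root
  decode (suc i) = [ reg , st ∘ state ]′ (splitAt m i)

  decode-code : ∀ a → decode (code a) ≡ a
  decode-code root    = refl
  decode-code (st q)  rewrite splitAt-↑ʳ m (length states) (index (listed q)) = cong st (sym (lookup-index (listed q)))
  decode-code (reg i) rewrite splitAt-↑ˡ m i (length states) = refl

  _≟ˢ_ : (p q : State) → Dec (p ≡ q)
  p ≟ˢ q = map′
    (λ eq → trans (lookup-index (listed p)) (trans (cong state eq) (sym (lookup-index (listed q)))))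
    (cong (index ∘ listed)) (index (listed p) ≟ᶠ index (listed q))

  Permits : State → Letter → Set
  Permits q root    = ⊤
  Permits q (st p)  = p ≡ q
  Permits q (reg i) = i ∉ forbidden q

  permits? : ∀ q a → Dec (Permits q a)
  permits? q root    = yes tt
  permits? q (st p)  = p ≟ˢ q
  permits? q (reg i) = ¬? (_∈?_ _≟ᶠ_ i (forbidden q))

  Hdg : Set
  Hdg = Hedge #letters

  -- Preorder reading of an arbitrary hedge. It gives every term a meaning as a word, so no
  -- invariant has to say that terms reachable from a flat term stay flat.
  flatten : Hdg → List Letter
  flatten []               = []
  flatten ((a ⟨ h ⟩) ∷ h′) = decode a ∷ flatten h ++ flatten h′

  flatten-++ : ∀ h h′ → flatten (h ++ h′) ≡ flatten h ++ flatten h′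
  flatten-++ []              h′ = refl
  flatten-++ ((a ⟨ g ⟩) ∷ h) h′ rewrite flatten-++ h h′ = cong (decode a ∷_) (sym (++-assoc (flatten g) _ _))

  -- The surrounding words depend on the context alone. Hence a rule applied anywhere in a tree
  -- replaces a factor of its preorder word.
  flatten-plug : ∀ C → ∃₂ λ x y → ∀ h → flatten (plug C h) ≡ x ++ flatten h ++ y
  flatten-plug (hole l r) = flatten l , flatten r , λ h →
    trans (flatten-++ l (h ++ r)) (cong (flatten l ++_) (flatten-++ h r))
  flatten-plug (deep l a C r) with x , y , eq ← flatten-plug C =
    flatten l ++ decode a ∷ x , y ++ flatten r , λ h → begin
      flatten (l ++ (a ⟨ plug C h ⟩) ∷ r)                     ≡⟨ flatten-++ l _ ⟩
      flatten l ++ decode a ∷ flatten (plug C h) ++ flatten r  ≡⟨ cong (λ w → flatten l ++ decode a ∷ w ++ flatten r) (eq h) ⟩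
      flatten l ++ decode a ∷ (x ++ flatten h ++ y) ++ flatten r
        ≡⟨ cong (λ w → flatten l ++ decode a ∷ w) (trans (++-assoc x _ _) (cong (x ++_) (++-assoc (flatten h) y _))) ⟩
      flatten l ++ decode a ∷ x ++ flatten h ++ y ++ flatten r ≡⟨ ++-assoc (flatten l) (decode a ∷ x) _ ⟨
      (flatten l ++ decode a ∷ x) ++ flatten h ++ y ++ flatten r ∎
    where open ≡-Reasoning

  leaf : Letter → Term #letters
  leaf a = code a ⟨ [] ⟩

  word : List Letter → Hdg
  word = map leaf

  tree : List Letter → Term #letters
  tree w = code root ⟨ word w ⟩

  flatten-word : ∀ w → flatten (word w) ≡ w
  flatten-word []      = refl
  flatten-word (a ∷ w) = cong₂ _∷_ (decode-code a) (flatten-word w)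

  -- A run of the automaton guesses the control state q and labels every node with
  -- it, after checking that the node's letter is compatible with q.
  constant : Fin (length states) → NFA (length states)
  constant i = record { m = 1 ; initial = [ zero ] ; final = [ zero ] ; δ = [ (zero , i , zero) ] }

  compatible? : ∀ ((i , a) : Fin (length states) × Fin #letters) → Dec (Permits (state i) (decode a))
  compatible? (i , a) = permits? (state i) (decode a)

  -- Built from `states` and `forbidden` only. The transitions are a parameter of a later module, so
  -- that constants inside them may depend on the code of this automaton.
  language : HA #letters
  language = record
    { k     = length states
    ; final = allFin _
    ; Δ     = map (λ (i , a) → a , constant i , i)
                  (filter compatible? (cartesianProduct (allFin _) (allFin _)))
    }

  path-constant : ∀ {i p w} → Path (constant i) p w → All (_≡ i) w
  path-constant (done _)               = []
  path-constant (step (here refl) rest) = refl ∷ path-constant rest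

  constant-path : ∀ i k → Path (constant i) zero (replicate k i)
  constant-path i zero    = done (here refl)
  constant-path i (suc k) = step (here refl) (constant-path i k)

  mutual
    reduces⇒permits : ∀ {t i} → Reduces language t i → All (Permits (state i)) (flatten [ t ])
    reduces⇒permits (node tr rs (_ , _ , path))
      with _ , sel , refl ← ∈-map⁻ _ tr =
      proj₂ (∈-filter⁻ compatible? {xs = cartesianProduct (allFin _) (allFin _)} sel) ∷
      All.++⁺ (pointwise⇒permits rs (path-constant path)) []

    pointwise⇒permits : ∀ {h is i} → Pointwise (Reduces language) h is → All (_≡ i) is →
                        All (Permits (state i)) (flatten h)
    pointwise⇒permits [] [] = []
    pointwise⇒permits {(a ⟨ h ⟩) ∷ h′} (r ∷ rs) (refl ∷ eqs)
      with p ∷ ps ← reduces⇒permits r =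
      p ∷ All.++⁺ (All.++⁻ˡ (flatten h) ps) (pointwise⇒permits rs eqs)

  permits⇒pointwise : ∀ {i} h → All (Permits (state i)) (flatten h) →
                      Pointwise (Reduces language) h (replicate (length h) i)
  permits⇒pointwise []               []       = []
  permits⇒pointwise {i} ((a ⟨ h ⟩) ∷ h′) (p ∷ ps) =
    node (∈-map⁺ _ (∈-filter⁺ compatible? (∈-cartesianProduct⁺ (∈-allFin i) (∈-allFin a)) p))
         (permits⇒pointwise h (All.++⁻ˡ (flatten h) ps))
         (zero , here refl , constant-path i (length h))
    ∷ permits⇒pointwise h′ (All.++⁻ʳ (flatten h) ps)

  tree∈language : ∀ {q w} → All (Permits q) w → InLang language (tree w)
  tree∈language {q} {w} ps
    with r ∷ [] ← permits⇒pointwise {index (listed q)} [ tree w ]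
           (tt ∷ All.++⁺ (subst (All _) (sym (flatten-word w))
                           (subst (λ p → All (Permits p) w) (lookup-index (listed q)) ps)) [])
    = _ , ∈-allFin _ , r

  -- Configurations read off from words

  asState : Letter → Maybe State
  asState (st q) = just q
  asState _      = nothing

  asRegister : Letter → Maybe (Fin m)
  asRegister (reg i) = just i
  asRegister _       = nothing

  control : List Letter → List State
  control = mapMaybe asState

  registers : List Letter → List (Fin m)
  registers = mapMaybe asRegister

  tally : List Letter → Counters m
  tally w i = count i (registers w)

  tally-++ : ∀ x y i → tally (x ++ y) i ≡ tally x i + tally y i
  tally-++ x y i = trans (cong (count i) (mapMaybe-++ asRegister x y)) (count-++ i (registers x) _)

  control-regs : ∀ is → control (map reg is) ≡ []
  control-regs []       = refl
  control-regs (i ∷ is) = control-regs is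

  registers-regs : ∀ is → registers (map reg is) ≡ is
  registers-regs []       = refl
  registers-regs (i ∷ is) = cong (i ∷_) (registers-regs is)

  control⇒∈ : ∀ {q} w → control w ≡ [ q ] → st q ∈ w
  control⇒∈ (root  ∷ w) eq   = there (control⇒∈ w eq)
  control⇒∈ (st _  ∷ w) eq   = here (cong st (sym (∷-injectiveˡ eq)))
  control⇒∈ (reg _ ∷ w) eq   = there (control⇒∈ w eq)

  registers⇒∈ : ∀ {i} w → i ∈ registers w → reg i ∈ w
  registers⇒∈ (root  ∷ w) i∈          = there (registers⇒∈ w i∈)
  registers⇒∈ (st _  ∷ w) i∈          = there (registers⇒∈ w i∈)
  registers⇒∈ (reg _ ∷ w) (here refl) = here refl
  registers⇒∈ (reg _ ∷ w) (there i∈)  = there (registers⇒∈ w i∈)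

  Enabled : State → Counters m → Set
  Enabled q c = All (λ i → c i ≡ 0) (forbidden q)

  -- The automaton cannot cheat: the control letter of `w` must itself be permitted, which forces
  -- the guessed state `p` to be `q`.
  permitted⇒enabled : ∀ {p q w} → control w ≡ [ q ] → All (Permits p) w → Enabled q (tally w)
  permitted⇒enabled {w = w} one ps with refl ← All.lookup ps (control⇒∈ w one) =
    All.tabulate λ i∈ → count-∉ (registers w) λ i∈w → All.lookup ps (registers⇒∈ w i∈w) i∈

  -- The transition (u , q′ , p) ∈ out q takes the register u (if any) down by one,
  -- adds p to the registers and moves to q′.
  module Run (out : State → List (Maybe (Fin m) × State × Counters m)) where

    -- `b` is the part of the counters that a transition leaves alone. Describing both sides as sums
    -- with `b` avoids subtraction, and pointwise equations stand in for function extensionality.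
    -- Halting requires empty registers because the target word is the halting letter alone.
    data Win : State → Counters m → Set where
      halted : ∀ {c} → (∀ i → c i ≡ 0) → Win halt c
      fire   : ∀ {q u q′ p c′ c} (b : Counters m) → (u , q′ , p) ∈ out q → Enabled q c →
               (∀ i → c i ≡ count i (fromMaybe u) + b i) → (∀ i → c′ i ≡ p i + b i) →
               Win q′ c′ → Win q c

    Win-cong : ∀ {q c d} → (∀ i → d i ≡ c i) → Win q c → Win q d
    Win-cong d≈c (halted z)           = halted λ i → trans (d≈c i) (z i)
    Win-cong d≈c (fire b tr en l r w) =
      fire b tr (All.map (trans (d≈c _)) en) (λ i → trans (d≈c i) (l i)) r w

    -- A transition needs its register letter next to the control letter; the commutations bring it there.
    data Rewrite : List Letter → List Letter → Set where
      transition : ∀ {q u q′ p} → (u , q′ , p) ∈ out q →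
                   Rewrite (st q ∷ map reg (fromMaybe u)) (st q′ ∷ map reg (spell p))
      right      : ∀ {q i} → Rewrite (st q ∷ reg i ∷ []) (reg i ∷ st q ∷ [])
      left       : ∀ {q i} → Rewrite (reg i ∷ st q ∷ []) (st q ∷ reg i ∷ [])

    commutations : State → Fin m → List (List Letter × List Letter)
    commutations q i = (st q ∷ reg i ∷ [] , reg i ∷ st q ∷ []) ∷ (reg i ∷ st q ∷ [] , st q ∷ reg i ∷ []) ∷ []

    rewritesOf : State → List (List Letter × List Letter)
    rewritesOf q =
      map (λ (u , q′ , p) → st q ∷ map reg (fromMaybe u) , st q′ ∷ map reg (spell p)) (out q)
      ++ concatMap (commutations q) (allFin m)

    rules : List (Hdg × Hdg)
    rules = map (λ (x , y) → word x , word y) (concatMap rewritesOf states)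

    rule : ∀ {x y} → Rewrite x y → (word x , word y) ∈ rules
    rule = ∈-map⁺ _ ∘ listedRewrite
      where
      at : ∀ {q x} → x ∈ rewritesOf q → x ∈ concatMap rewritesOf states
      at {q} h = ∈-concatMap⁺ rewritesOf (lose (listed q) h)

      listedRewrite : ∀ {x y} → Rewrite x y → (x , y) ∈ concatMap rewritesOf states
      listedRewrite (transition tr)  = at (∈-++⁺ˡ (∈-map⁺ _ tr))
      listedRewrite (right {q} {i}) = at (∈-++⁺ʳ (map _ (out q)) (∈-concatMap⁺ (commutations q) (lose (∈-allFin i) (here refl))))
      listedRewrite (left {q} {i})  = at (∈-++⁺ʳ (map _ (out q)) (∈-concatMap⁺ (commutations q) (lose (∈-allFin i) (there (here refl)))))

    unrule : ∀ {ℓ r} → (ℓ , r) ∈ rules → ∃₂ λ x y → ℓ ≡ word x × r ≡ word y × Rewrite x y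
    unrule ℓr∈ with (x , y) , xy∈ , refl ← ∈-map⁻ _ ℓr∈
               with q , _ , xy∈q ← find (∈-concatMap⁻ rewritesOf {xs = states} xy∈)
               with ∈-++⁻ (map _ (out q)) xy∈q
    ... | inj₁ tr with _ , tr∈ , refl ← ∈-map⁻ _ tr = _ , _ , refl , refl , transition tr∈
    ... | inj₂ com with find (∈-concatMap⁻ (commutations q) {xs = allFin m} com)
    ...   | _ , _ , here refl         = _ , _ , refl , refl , right
    ...   | _ , _ , there (here refl) = _ , _ , refl , refl , left

    instanceFrom : State → List (Fin m) → Instance
    instanceFrom q is = record
      { n = #letters ; L = language ; rules = rules
      ; src = tree (st q ∷ map reg is) ; tgt = tree [ st halt ] }

    -- From winning runs to rewrite sequences

    module _ (q₀ : State) (is₀ : List (Fin m)) where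

      _⟶*_ : Term #letters → Term #letters → Set
      _⟶*_ = Star (RStep (instanceFrom q₀ is₀))

      rewriteTree : ∀ {q x y} → Rewrite x y → ∀ l r → All (Permits q) (l ++ x ++ r) →
                    tree (l ++ x ++ r) ⟶* tree (l ++ y ++ r)
      rewriteTree {x = x} {y} rw l r ps =
        ((word x , word y) , rule rw , tree∈language ps ,
          deep [] (code root) (hole (word l) (word r)) [] , spread x , spread y) ◅ ε
        where
        spread : ∀ z → [ code root ⟨ word l ++ word z ++ word r ⟩ ] ≡ [ tree (l ++ z ++ r) ]
        spread z = cong (λ h → [ code root ⟨ h ⟩ ])
          (trans (cong (word l ++_) (sym (map-++ leaf z r))) (sym (map-++ leaf l (z ++ r))))

      assoc⟶* : ∀ l a x y → tree ((l ++ [ a ]) ++ x) ⟶* tree ((l ++ [ a ]) ++ y) →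
                tree (l ++ a ∷ x) ⟶* tree (l ++ a ∷ y)
      assoc⟶* l a x y rewrite ++-assoc l [ a ] x | ++-assoc l [ a ] y = λ s → s

      moveRight : ∀ {q r} l is → All (Permits q) l → All (Permits q) (map reg is) → All (Permits q) r →
                  tree (l ++ st q ∷ map reg is ++ r) ⟶* tree (l ++ map reg is ++ st q ∷ r)
      moveRight l []       pl ps       pr = ε
      moveRight l (i ∷ is) pl (p ∷ ps) pr =
        rewriteTree right l (map reg is ++ _) (All.++⁺ pl (refl ∷ p ∷ All.++⁺ ps pr)) ◅◅
        assoc⟶* l (reg i) _ _ (moveRight (l ++ [ reg i ]) is (All.++⁺ pl (p ∷ [])) ps pr)

      moveLeft : ∀ {q r} l is → All (Permits q) l → All (Permits q) (map reg is) → All (Permits q) r →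
                 tree (l ++ map reg is ++ st q ∷ r) ⟶* tree (l ++ st q ∷ map reg is ++ r)
      moveLeft l []       pl ps       pr = ε
      moveLeft l (i ∷ is) pl (p ∷ ps) pr =
        assoc⟶* l (reg i) _ _ (moveLeft (l ++ [ reg i ]) is (All.++⁺ pl (p ∷ [])) ps pr) ◅◅
        rewriteTree left l (map reg is ++ _) (All.++⁺ pl (p ∷ refl ∷ All.++⁺ ps pr))

      enabled⇒permitted : ∀ {q c} is → Enabled q c → (∀ i → count i is ≡ c i) → All (Permits q) (map reg is)
      enabled⇒permitted is en eq = All.map⁺ (All.tabulate λ i∈ i∈f → ∈⇒count≢0 i∈ (trans (eq _) (All.lookup en i∈f)))

      -- The control letter travels to the left end and then right, up to an occurrence of the
      -- register to be decremented. Commutations change neither the state nor the counts, so all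
      -- intermediate words satisfy the constraint as soon as the first one does.
      focus : ∀ {q c} is js → Enabled q c → (∀ i → count i (is ++ js) ≡ c i) → ∀ u (b : Counters m) →
              (∀ i → c i ≡ count i (fromMaybe u) + b i) →
              ∃₂ λ is′ js′ → (∀ i → count i (is′ ++ js′) ≡ b i) ×
              All (Permits q) (map reg is′ ++ st q ∷ map reg (fromMaybe u) ++ map reg js′) ×
              tree (map reg is ++ st q ∷ map reg js) ⟶*
              tree (map reg is′ ++ st q ∷ map reg (fromMaybe u) ++ map reg js′)
      focus {q} is js en eq nothing b cb = is , js , (λ i → trans (eq i) (cb i)) , pq , ε
        where
        ps = subst (All (Permits q)) (map-++ reg is js) (enabled⇒permitted (is ++ js) en eq)
        pq = All.++⁺ (All.++⁻ˡ (map reg is) ps) (refl ∷ All.++⁻ʳ (map reg is) ps)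
      focus {q} is js en eq (just x) b cb
        with is′ , js′ , eq′ ← ∈-∃++ (count⇒∈ (is ++ js) (trans (eq x) (trans (cb x) (cong (λ k → k + 0 + b x) (δ-refl x)))))
        = is′ , js′ , counts , All.++⁺ p₁ (refl ∷ p₂) ,
          (moveLeft [] is [] (All.++⁻ˡ (map reg is) ps) (All.++⁻ʳ (map reg is) ps) ◅◅
           subst (λ w → tree (st q ∷ w) ⟶* tree (map reg is′ ++ st q ∷ reg x ∷ map reg js′)) same
             (moveRight [] is′ [] p₁ p₂))
        where
        same : map reg is′ ++ map reg (x ∷ js′) ≡ map reg is ++ map reg js
        same = trans (sym (map-++ reg is′ _)) (trans (cong (map reg) (sym eq′)) (map-++ reg is js))
        ps = subst (All (Permits q)) (map-++ reg is js) (enabled⇒permitted (is ++ js) en eq)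
        ps′ = subst (All (Permits q)) (sym same) ps
        p₁ = All.++⁻ˡ (map reg is′) ps′
        p₂ = All.++⁻ʳ (map reg is′) ps′
        counts : ∀ i → count i (is′ ++ js′) ≡ b i
        counts i = +-cancelˡ-≡ (δ x i) _ _ (begin
          δ x i + count i (is′ ++ js′)            ≡⟨ cong (δ x i +_) (count-++ i is′ js′) ⟩
          δ x i + (count i is′ + count i js′)     ≡⟨ x∙yz≈y∙xz (δ x i) (count i is′) _ ⟩
          count i is′ + count i (x ∷ js′)         ≡⟨ count-++ i is′ _ ⟨
          count i (is′ ++ x ∷ js′)                ≡⟨ cong (count i) eq′ ⟨
          count i (is ++ js)                      ≡⟨ trans (eq i) (cb i) ⟩
          δ x i + 0 + b i                         ≡⟨ cong (_+ b i) (+-identityʳ (δ x i)) ⟩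
          δ x i + b i ∎)
          where open ≡-Reasoning

      -- The position of the control letter is left arbitrary, since a transition fires, and leaves
      -- it, in the middle of the word.
      win⇒⟶* : ∀ {q c} → Win q c → ∀ is js → (∀ i → count i (is ++ js) ≡ c i) →
               tree (map reg is ++ st q ∷ map reg js) ⟶* tree [ st halt ]
      win⇒⟶* (halted z) is js eq with count≡0⇒[] (is ++ js) (λ i → trans (eq i) (z i))
      win⇒⟶* (halted z) [] [] eq | refl = ε
      win⇒⟶* (fire {u = u} {q′} {p} {c′} b tr en cl cr w) is js eq
        with is′ , js′ , counts , ps , s ← focus is js en eq u b cl =
        s ◅◅ rewriteTree (transition tr) (map reg is′) (map reg js′) ps ◅◅
        subst (λ z → tree (map reg is′ ++ st q′ ∷ z) ⟶* tree [ st halt ]) (map-++ reg (spell p) js′)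
          (win⇒⟶* w is′ (spell p ++ js′) counts′)
        where
        counts′ : ∀ i → count i (is′ ++ spell p ++ js′) ≡ c′ i
        counts′ i = begin
          count i (is′ ++ spell p ++ js′)                  ≡⟨ count-++ i is′ _ ⟩
          count i is′ + count i (spell p ++ js′)            ≡⟨ cong (count i is′ +_) (count-++ i (spell p) js′) ⟩
          count i is′ + (count i (spell p) + count i js′)   ≡⟨ cong (λ k → count i is′ + (k + count i js′)) (count-spell p i) ⟩
          count i is′ + (p i + count i js′)                 ≡⟨ x∙yz≈y∙xz (count i is′) (p i) _ ⟩
          p i + (count i is′ + count i js′)                 ≡⟨ cong (p i +_) (count-++ i is′ js′) ⟨
          p i + count i (is′ ++ js′)                        ≡⟨ cong (p i +_) (counts i) ⟩
          p i + b i                                         ≡⟨ cr i ⟨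
          c′ i ∎
          where open ≡-Reasoning

      -- From rewrite sequences to winning runs

      controlAround : ∀ x y {p q} → control x ++ p ∷ control y ≡ [ q ] → control x ≡ [] × p ≡ q × control y ≡ []
      controlAround x y eq with control x | control y
      controlAround x y refl | [] | [] = refl , refl , refl
      controlAround x y () | _ ∷ [] | _
      controlAround x y () | _ ∷ _ ∷ _ | _

      module _ (x y : List Letter) where

        control-++ : ∀ z → control (x ++ z ++ y) ≡ control x ++ control z ++ control y
        control-++ z = trans (mapMaybe-++ asState x _) (cong (control x ++_) (mapMaybe-++ asState z y))

        tally-++₃ : ∀ z i → tally (x ++ z ++ y) i ≡ tally z i + (tally x i + tally y i)
        tally-++₃ z i = trans (trans (tally-++ x _ i) (cong (tally x i +_) (tally-++ z y i))) (x∙yz≈y∙xz (tally x i) (tally z i) _)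

        tally-swap : ∀ z z′ → registers z ≡ registers z′ → ∀ i → tally (x ++ z ++ y) i ≡ tally (x ++ z′ ++ y) i
        tally-swap z z′ eq i = trans (tally-++₃ z i) (trans (cong (λ is → count i is + (tally x i + tally y i)) eq) (sym (tally-++₃ z′ i)))

        -- A commutation preserves control and tally, so it costs no step of the machine. In a
        -- transition the letter rewritten is the only control letter, so the surroundings
        -- contribute register letters alone, and these form the untouched part.
        rewriteBack : ∀ {a b q} → Rewrite a b → control (x ++ a ++ y) ≡ [ q ] → Enabled q (tally (x ++ a ++ y)) →
                      (∀ {p} → control (x ++ b ++ y) ≡ [ p ] → Win p (tally (x ++ b ++ y))) →
                      Win q (tally (x ++ a ++ y))
        rewriteBack {a} {b} (transition {p} {u} {q′} {f} tr) one en win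
          with cx , refl , cy ← controlAround x y (trans (sym (trans (control-++ a)
                 (cong (λ k → control x ++ p ∷ k ++ control y) (control-regs (fromMaybe u))))) one)
          = fire (λ i → tally x i + tally y i) tr en
              (λ i → trans (tally-++₃ a i) (cong (λ is → count i is + (tally x i + tally y i)) (registers-regs (fromMaybe u))))
              (λ i → trans (tally-++₃ b i) (cong (_+ (tally x i + tally y i)) (trans (cong (count i) (registers-regs (spell f))) (count-spell f i))))
              (win (trans (control-++ b) (trans (cong (λ k → control x ++ q′ ∷ k ++ control y) (control-regs (spell f)))
                     (cong₂ (λ k k′ → k ++ q′ ∷ k′) cx cy))))
        rewriteBack {a} {b} right one en win = Win-cong (tally-swap a b refl) (win (trans (control-++ b) (trans (sym (control-++ a)) one)))
        rewriteBack {a} {b} left  one en win = Win-cong (tally-swap a b refl) (win (trans (control-++ b) (trans (sym (control-++ a)) one)))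

      -- Holds for every term with a single control letter, flat or not. Membership of the term in
      -- the constraint language, demanded by each rewrite step, yields the zero tests.
      ⟶*⇒win : ∀ {q t} → t ⟶* tree [ st halt ] → control (flatten [ t ]) ≡ [ q ] → Win q (tally (flatten [ t ]))
      ⟶*⇒win {q} ε one
        with refl ← trans (sym (cong (control ∘ (root ∷_)) (trans (++-identityʳ _) (flatten-word [ st halt ])))) one =
        halted λ i → cong (λ w → tally (root ∷ w) i) (trans (++-identityʳ _) (flatten-word [ st halt ]))
      ⟶*⇒win {q} (((ℓ , r) , ℓr∈ , (_ , _ , red) , C , before , after) ◅ s) one
        with a , b , refl , refl , rw ← unrule ℓr∈
        with x , y , flat ← flatten-plug C =
        subst (Win q ∘ tally) (sym from)
          (rewriteBack x y rw (trans (cong control (sym from)) one)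
            (subst (Enabled q ∘ tally) from (permitted⇒enabled one (reduces⇒permits red)))
            λ {p} one′ → subst (Win p ∘ tally) to (⟶*⇒win s (trans (cong control to) one′)))
        where
        at : ∀ {t} z → plug C (word z) ≡ [ t ] → flatten [ t ] ≡ x ++ z ++ y
        at z eq = trans (cong flatten (sym eq)) (trans (flat (word z)) (cong (λ w → x ++ w ++ y) (flatten-word z)))
        from = at a before
        to = at b after

      reach⇒win : Reach (instanceFrom q₀ is₀) → Win q₀ (λ i → count i is₀)
      reach⇒win s = Win-cong (λ i → sym (trans (cong (λ w → tally w i) flat) (cong (count i) (registers-regs is₀))))
        (⟶*⇒win s (trans (cong control flat) (cong (q₀ ∷_) (control-regs is₀))))
        where
        flat : flatten [ tree (st q₀ ∷ map reg is₀) ] ≡ root ∷ st q₀ ∷ map reg is₀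
        flat = cong (root ∷_) (trans (++-identityʳ _) (flatten-word (st q₀ ∷ map reg is₀)))

      win⇒reach : Win q₀ (λ i → count i is₀) → Reach (instanceFrom q₀ is₀)
      win⇒reach w = win⇒⟶* w [] is₀ (λ _ → refl)

-- Register programs: bounds and determinism

clip : ∀ {k} → ℕ → Fin (suc k)
clip {k} j = j mod suc k

toℕ-clip : ∀ {k j} → j < suc k → toℕ (clip {k} j) ≡ j
toℕ-clip j<n = trans (toℕ-fromℕ< _) (m<n⇒m%n≡m j<n)

clip-toℕ : ∀ {k} (i : Fin (suc k)) → clip (toℕ i) ≡ i
clip-toℕ i = toℕ-injective (toℕ-clip (toℕ<n i))

update-≡ : ∀ R r v → update R r v r ≡ v
update-≡ R r v = cong (if_then v else R r) (dec-true (r ≟ r) refl)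

update-≢ : ∀ R v {r j} → ¬ (j ≡ r) → update R r v j ≡ R j
update-≢ R v {r} {j} j≢r = cong (if_then v else R j) (dec-false (j ≟ r) j≢r)

-- Each instruction weighs at least 1 and more than any register or jump target it names. The sum
-- over the program thus bounds every register, jump target and successor address, so reducing these
-- modulo the successor of the sum loses nothing.
instrSize : Instr → ℕ
instrSize (inc r)     = suc r
instrSize (decjz r j) = suc (r + j)

programSize : Program → ℕ
programSize = sum ∘ map instrSize

nth-size : ∀ P pc {i} → nth P pc ≡ just i → pc + instrSize i ≤ programSize P
nth-size (x ∷ P) zero     refl = m≤m+n (instrSize x) _
nth-size (x ∷ P) (suc pc) eq   = +-mono-≤ (instrSize>0 x) (nth-size P pc eq)
  where
  instrSize>0 : ∀ x → 1 ≤ instrSize x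
  instrSize>0 (inc _)     = s≤s z≤n
  instrSize>0 (decjz _ _) = s≤s z≤n

run-deterministic : ∀ P f g {c d e} → run P f c ≡ just d → run P g c ≡ just e → d ≡ e
run-deterministic P (suc f) (suc g) {pc , R} eq eq′ with nth P pc
... | nothing          = just-injective (trans (sym eq) eq′)
... | just (inc r)     = run-deterministic P f g eq eq′
... | just (decjz r j) with R r
...   | zero  = run-deterministic P f g eq eq′
...   | suc v = run-deterministic P f g eq eq′

computes-unique : ∀ P {x y z} → Computes P x y → Computes P x z → y ≡ z
computes-unique P (f , c , runs , c≡y) (g , d , runs′ , d≡z) =
  trans (sym c≡y) (trans (cong (λ e → proj₂ e 0) (run-deterministic P f g runs runs′)) d≡z)

Outputs0 : Program → ℕ → Regs → Set
Outputs0 P pc R = ∃₂ λ fuel d → run P fuel (pc , R) ≡ just d × proj₂ d 0 ≡ 0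

module Steps (P : Program) where

  outputs-halt : ∀ {pc R} → nth P pc ≡ nothing → R 0 ≡ 0 → Outputs0 P pc R
  outputs-halt {pc} {R} eq R₀ = 1 , (pc , R) , stop , R₀
    where
    stop : run P 1 (pc , R) ≡ just (pc , R)
    stop rewrite eq = refl

  outputs-inc : ∀ {pc R r} → nth P pc ≡ just (inc r) →
                Outputs0 P (suc pc) (update R r (suc (R r))) → Outputs0 P pc R
  outputs-inc {pc} {R} {r} eq (f , d , runs , d₀) = suc f , d , trans next runs , d₀
    where
    next : run P (suc f) (pc , R) ≡ run P f (suc pc , update R r (suc (R r)))
    next rewrite eq = refl

  outputs-dec : ∀ {pc R r j v} → nth P pc ≡ just (decjz r j) → R r ≡ suc v →
                Outputs0 P (suc pc) (update R r v) → Outputs0 P pc R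
  outputs-dec {pc} {R} {r} {v = v} eq eqr (f , d , runs , d₀) = suc f , d , trans next runs , d₀
    where
    next : run P (suc f) (pc , R) ≡ run P f (suc pc , update R r v)
    next rewrite eq | eqr = refl

  outputs-jump : ∀ {pc R r j} → nth P pc ≡ just (decjz r j) → R r ≡ 0 → Outputs0 P j R → Outputs0 P pc R
  outputs-jump {pc} {R} {r} {j} eq eqr (f , d , runs , d₀) = suc f , d , trans next runs , d₀
    where
    next : run P (suc f) (pc , R) ≡ run P f (j , R)
    next rewrite eq | eqr = refl

-- One counter machine: a loader followed by the simulation of P

module Reduction (P : Program) where

  open Steps P

  top : ℕ
  top = programSize P

  -- `A` counts the iterations left, `H` holds the exponent, `T` is scratch space for
  -- multiplications, and `V` is the summand to be multiplied by the power. `M i` is register `i` of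
  -- `P`; `M zero` also accumulates the loaded number.
  pattern A   = zero
  pattern H   = suc zero
  pattern T   = suc (suc zero)
  pattern V   = suc (suc (suc zero))
  pattern M i = suc (suc (suc (suc i)))

  Register : Set
  Register = Fin (4 + suc top)

  data State : Set where
    take scaleH scaledH restoreH power scaleV scaledV restoreV move start clear : State
    at test : Fin (suc top) → State

  states : List State
  states = take ∷ scaleH ∷ scaledH ∷ restoreH ∷ power ∷ scaleV ∷ scaledV ∷ restoreV ∷ move ∷ start ∷ clear ∷
           map at (allFin _) ++ map test (allFin _)

  listed : ∀ q → q ∈ states
  listed take      = here refl
  listed scaleH    = there (here refl)
  listed scaledH   = there (there (here refl))
  listed restoreH  = there (there (there (here refl)))
  listed power     = there (there (there (there (here refl))))
  listed scaleV    = there (there (there (there (there (here refl)))))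
  listed scaledV   = there (there (there (there (there (there (here refl))))))
  listed restoreV  = there (there (there (there (there (there (there (here refl)))))))
  listed move      = there (there (there (there (there (there (there (there (here refl))))))))
  listed start     = there (there (there (there (there (there (there (there (there (here refl)))))))))
  listed clear     = there (there (there (there (there (there (there (there (there (there (here refl))))))))))
  listed (at pc)   = there (there (there (there (there (there (there (there (there (there (there (∈-++⁺ˡ (∈-map⁺ at (∈-allFin pc)))))))))))))
  listed (test pc) = there (there (there (there (there (there (there (there (there (there (there (∈-++⁺ʳ (map at (allFin _)) (∈-map⁺ test (∈-allFin pc)))))))))))))

  tested : Maybe Instr → List Register
  tested (just (decjz r _)) = [ M (clip r) ]
  tested _                  = []

  -- A loop is left by a guess, which is checked in the state entered next: `scaledH` and `scaledV`
  -- confirm that scaling is complete, `T` in `take` and `power` that restoring is, and `A` in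
  -- `power`, `H` in `move`, `V` in `start` that these registers are used up. `clear` lets only
  -- output 0 through.
  forbidden : State → List Register
  forbidden take      = [ T ]
  forbidden scaledH   = [ H ]
  forbidden power     = A ∷ T ∷ []
  forbidden scaledV   = [ V ]
  forbidden move      = A ∷ H ∷ T ∷ []
  forbidden start     = A ∷ H ∷ T ∷ V ∷ map (λ i → M (suc i)) (allFin _)
  forbidden (test pc) = tested (nth P (toℕ pc))
  forbidden clear     = [ M zero ]
  forbidden _         = []

  open Machine states listed forbidden clear public

  counters : (a h t v x : ℕ) → Counters (4 + suc top)
  counters a h t v x A           = a
  counters a h t v x H           = h
  counters a h t v x T           = t
  counters a h t v x V           = v
  counters a h t v x (M zero)    = x
  counters a h t v x (M (suc _)) = 0

  M-injective : ∀ {i j : Fin (suc top)} → _≡_ {A = Register} (M i) (M j) → i ≡ j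
  M-injective refl = refl

  none : Counters (4 + suc top)
  none _ = 0

  byRegister : {f g : Counters (4 + suc top)} →
               f A ≡ g A → f H ≡ g H → f T ≡ g T → f V ≡ g V → f (M zero) ≡ g (M zero) →
               (∀ i → f (M (suc i)) ≡ g (M (suc i))) → ∀ i → f i ≡ g i
  byRegister a h t v x m A           = a
  byRegister a h t v x m H           = h
  byRegister a h t v x m T           = t
  byRegister a h t v x m V           = v
  byRegister a h t v x m (M zero)    = x
  byRegister a h t v x m (M (suc i)) = m i

  Transition : Set
  Transition = Maybe Register × State × Counters (4 + suc top)

  instruction : Fin (suc top) → Maybe Instr → List Transition
  instruction pc nothing            = [ (nothing , clear , none) ]
  instruction pc (just (inc r))     = [ (nothing , at (clip (suc (toℕ pc))) , δ (M (clip r))) ]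
  instruction pc (just (decjz r j)) = (just (M (clip r)) , at (clip (suc (toℕ pc))) , none) ∷ (nothing , test pc , none) ∷ []

  branch : Maybe Instr → List Transition
  branch (just (decjz r j)) = [ (nothing , at (clip j) , none) ]
  branch _                  = []

  -- Registers beyond `top` are not named by `P`, and `clip` would wrap them around.
  Simulates : Counters (4 + suc top) → Regs → Set
  Simulates c R = ∀ {j} → j < suc top → R j ≡ c (M (clip j))

  simulates-update : ∀ {c c′ R r v} → Simulates c R → r < suc top → c′ (M (clip r)) ≡ v →
                     (∀ {i} → ¬ (i ≡ clip r) → c′ (M i) ≡ c (M i)) → Simulates c′ (update R r v)
  simulates-update {R = R} {r} {v} sim r< eq same {j} j< with j ≟ r
  ... | yes refl = trans (update-≡ R r v) (sym eq)
  ... | no  j≢r  = trans (update-≢ R v j≢r) (trans (sim j<)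
        (sym (same λ e → j≢r (trans (sym (toℕ-clip j<)) (trans (cong toℕ e) (toℕ-clip r<))))))

  module _ {pc : ℕ} where

    next< : ∀ {i} → nth P pc ≡ just i → suc pc < suc top
    next< {i} eq = s≤s (≤-trans (≤-trans (≤-reflexive (+-comm 1 pc)) (+-monoʳ-≤ pc (positive i))) (nth-size P pc eq))
      where
      positive : ∀ i → 1 ≤ instrSize i
      positive (inc _)     = s≤s z≤n
      positive (decjz _ _) = s≤s z≤n

    inc< : ∀ {r} → nth P pc ≡ just (inc r) → r < suc top
    inc< eq = s≤s (≤-trans (n≤1+n _) (≤-trans (m≤n+m _ pc) (nth-size P pc eq)))

    dec< : ∀ {r j} → nth P pc ≡ just (decjz r j) → r < suc top
    dec< eq = s≤s (≤-trans (≤-trans (m≤m+n _ _) (n≤1+n _)) (≤-trans (m≤n+m _ pc) (nth-size P pc eq)))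

    jump< : ∀ {r j} → nth P pc ≡ just (decjz r j) → j < suc top
    jump< {r} eq = s≤s (≤-trans (≤-trans (m≤n+m _ r) (n≤1+n _)) (≤-trans (m≤n+m _ pc) (nth-size P pc eq)))

  -- The loader turns A = a into M 0 = c₀ + a c₁ + a c₂ K ^ h, where h is obtained
  -- from 0 by a-fold iteration of h ↦ ν + μ h.
  module Loader (c₀ c₁ c₂ K μ ν : ℕ) where

    -- Each unit of `A` adds c₁ to `M zero` and c₂ to `V`, and replaces H by ν + μ H: scaling moves
    -- `H` into `T` with factor μ, restoring moves it back, and ν is added on exit. Each unit of `H`
    -- then multiplies `V` by K through `T`; `move` adds `V` and finally c₀ to `M zero`.
    out : State → List Transition
    out take      = (just A , scaleH , counters 0 0 0 c₂ c₁) ∷ (nothing , power , none) ∷ []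
    out scaleH    = (just H , scaleH , counters 0 0 μ 0 0) ∷ (nothing , scaledH , none) ∷ []
    out scaledH   = (nothing , restoreH , none) ∷ []
    out restoreH  = (just T , restoreH , counters 0 1 0 0 0) ∷ (nothing , take , counters 0 ν 0 0 0) ∷ []
    out power     = (just H , scaleV , none) ∷ (nothing , move , none) ∷ []
    out scaleV    = (just V , scaleV , counters 0 0 K 0 0) ∷ (nothing , scaledV , none) ∷ []
    out scaledV   = (nothing , restoreV , none) ∷ []
    out restoreV  = (just T , restoreV , counters 0 0 0 1 0) ∷ (nothing , power , none) ∷ []
    out move      = (just V , move , counters 0 0 0 0 1) ∷ (nothing , start , counters 0 0 0 0 c₀) ∷ []
    out start     = (nothing , at zero , none) ∷ []
    out (at pc)   = instruction pc (nth P (toℕ pc))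
    out (test pc) = branch (nth P (toℕ pc))
    out clear     = map (λ i → just i , clear , none) (allFin _)

    open Run out public

    -- Soundness: a winning run forces output 0

    total : (a h v x : ℕ) → ℕ
    total zero    h v x = x + v * K ^ h
    total (suc a) h v x = total a (ν + μ * h) (c₂ + v) (c₁ + x)

    -- The number that the loader will pass on if it does not get stuck; every step conserves it.
    worth : State → (a h t v x : ℕ) → ℕ
    worth take     a h t v x = c₀ + total a (h + t) v x
    worth scaleH   a h t v x = c₀ + total a (ν + (μ * h + t)) v x
    worth scaledH  a h t v x = c₀ + total a (ν + (μ * h + t)) v x
    worth restoreH a h t v x = c₀ + total a (ν + (h + t)) v x
    worth scaleV   a h t v x = c₀ + total a h (K * v + t) x
    worth scaledV  a h t v x = c₀ + total a h (K * v + t) x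
    worth start    a h t v x = x + v
    worth _        a h t v x = c₀ + total a h (v + t) x

    worthOf : State → Counters (4 + suc top) → ℕ
    worthOf s c = worth s (c A) (c H) (c T) (c V) (c (M zero))

    worthOf-cong : ∀ s {c d} → (∀ i → c i ≡ d i) → worthOf s c ≡ worthOf s d
    worthOf-cong s eq rewrite eq A | eq H | eq T | eq V | eq (M zero) = refl

    -- What a winning run from here establishes about `P`. Simulation states speak of all `R` that
    -- agree with `c`, so no register function has to be extracted from `c`; at `test` the claim
    -- includes that the guessed zero is one.
    Good : State → Counters (4 + suc top) → Set
    Good (at pc)   c = ∀ R → Simulates c R → Outputs0 P (toℕ pc) R
    Good (test pc) c = ∀ {r j} → nth P (toℕ pc) ≡ just (decjz r j) → ∀ R → Simulates c R → R r ≡ 0 × Outputs0 P j R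
    Good clear     c = c (M zero) ≡ 0
    Good s         c = Outputs0 P 0 (initRegs (worthOf s c))

    Passes : ℕ → Set
    Passes e = Outputs0 P 0 (initRegs e)

    conserve : ∀ s s′ {c c′ f g} → (∀ i → c i ≡ f i) → (∀ i → c′ i ≡ g i) →
               worthOf s f ≡ worthOf s′ g → Passes (worthOf s′ c′) → Passes (worthOf s c)
    conserve s s′ cf cg eq = subst Passes (trans (worthOf-cong s′ cg) (sym (trans (worthOf-cong s cf) eq)))

    take-scaleH : ∀ a h {t} v x → t ≡ 0 → worth take (suc a) h t v x ≡ worth scaleH a h t (c₂ + v) (c₁ + x)
    take-scaleH a h v x refl = cong (λ k → c₀ + total a (ν + k) (c₂ + v) (c₁ + x)) (lemma μ h)
      where
      lemma : ∀ μ h → μ * (h + 0) ≡ μ * h + 0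
      lemma = solve-∀

    take-power : ∀ a h {t} v x → t ≡ 0 → worth take a h t v x ≡ worth power a h t v x
    take-power a h v x refl = cong₂ (λ k l → c₀ + total a k l x) (+-identityʳ h) (sym (+-identityʳ v))

    scaleH-scaleH : ∀ a h t v x → worth scaleH a (suc h) t v x ≡ worth scaleH a h (μ + t) v x
    scaleH-scaleH a h t v x = cong (λ k → c₀ + total a (ν + k) v x) (lemma μ h t)
      where
      lemma : ∀ μ h t → μ * (1 + h) + t ≡ μ * h + (μ + t)
      lemma = solve-∀

    scaledH-restoreH : ∀ a {h} t v x → h ≡ 0 → worth scaledH a h t v x ≡ worth restoreH a h t v x
    scaledH-restoreH a t v x refl = cong (λ k → c₀ + total a (ν + (k + t)) v x) (*-zeroʳ μ)

    restoreH-restoreH : ∀ a h t v x → worth restoreH a h (suc t) v x ≡ worth restoreH a (suc h) t v x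
    restoreH-restoreH a h t v x = cong (λ k → c₀ + total a (ν + k) v x) (+-suc h t)

    restoreH-take : ∀ a h t v x → worth restoreH a h t v x ≡ worth take a (ν + h) t v x
    restoreH-take a h t v x = cong (λ k → c₀ + total a k v x) (sym (+-assoc ν h t))

    -- One factor K leaves the power K ^ (1 + h) and becomes the pending multiplication of `V`.
    power-scaleV : ∀ {a} h {t} v x → a ≡ 0 → t ≡ 0 → worth power a (suc h) t v x ≡ worth scaleV a h t v x
    power-scaleV h v x refl refl = cong (λ k → c₀ + (x + k)) (lemma K v (K ^ h))
      where
      lemma : ∀ K v w → (v + 0) * (K * w) ≡ (K * v + 0) * w
      lemma = solve-∀

    scaleV-scaleV : ∀ a h t v x → worth scaleV a h t (suc v) x ≡ worth scaleV a h (K + t) v x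
    scaleV-scaleV a h t v x = cong (λ k → c₀ + total a h k x) (lemma K v t)
      where
      lemma : ∀ K v t → K * (1 + v) + t ≡ K * v + (K + t)
      lemma = solve-∀

    scaledV-restoreV : ∀ a h t {v} x → v ≡ 0 → worth scaledV a h t v x ≡ worth restoreV a h t v x
    scaledV-restoreV a h t x refl = cong (λ k → c₀ + total a h (k + t) x) (*-zeroʳ K)

    restoreV-restoreV : ∀ a h t v x → worth restoreV a h (suc t) v x ≡ worth restoreV a h t (suc v) x
    restoreV-restoreV a h t v x = cong (λ k → c₀ + total a h k x) (+-suc v t)

    move-move : ∀ {a h t} v x → a ≡ 0 → h ≡ 0 → t ≡ 0 → worth move a h t (suc v) x ≡ worth move a h t v (suc x)
    move-move v x refl refl refl = cong (c₀ +_) (+-suc x ((v + 0) * 1))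

    move-start : ∀ {a h t} v x → a ≡ 0 → h ≡ 0 → t ≡ 0 → worth move a h t v x ≡ worth start a h t v (c₀ + x)
    move-start v x refl refl refl = lemma c₀ v x
      where
      lemma : ∀ c v x → c + (x + (v + 0) * 1) ≡ c + x + v
      lemma = solve-∀

    -- The constraint on `start` itself enforces that all `M (suc i)` are empty, so the loader
    -- invariant does not track them.
    good-start : ∀ {c} → Enabled start c → Good (at zero) c → Good start c
    good-start {c} (a₀ ∷ h₀ ∷ t₀ ∷ v₀ ∷ m₀) g = g (initRegs (c (M zero) + c V)) sim
      where
      sim : Simulates c (initRegs (c (M zero) + c V))
      sim {zero}  _ = trans (cong (c (M zero) +_) v₀) (trans (+-identityʳ _) (cong (λ i → c (M i)) (sym (clip-toℕ zero))))
      sim {suc j} (s≤s j<) = sym (trans (cong (λ i → c (M i)) (toℕ-injective (trans (toℕ-clip (s≤s j<)) (cong suc (sym (toℕ-fromℕ< j<))))))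
        (All.lookup (All.map⁻ m₀) (∈-allFin (fromℕ< j<))))

    Good-next : Fin (suc top) → Counters (4 + suc top) → Set
    Good-next pc c = Good (at (clip (suc (toℕ pc)))) c

    outputs-next : ∀ {pc c i} → nth P (toℕ pc) ≡ just i → Good-next pc c → ∀ R → Simulates c R → Outputs0 P (suc (toℕ pc)) R
    outputs-next {pc} eq g R sim = subst (λ k → Outputs0 P k R) (toℕ-clip (next< eq)) (g R sim)

    good-instruction : ∀ {pc c c′ u q′ p} (b : Counters (4 + suc top)) mi → nth P (toℕ pc) ≡ mi →
                       (u , q′ , p) ∈ instruction pc mi →
                       (∀ i → c i ≡ count i (fromMaybe u) + b i) → (∀ i → c′ i ≡ p i + b i) →
                       Good q′ c′ → Good (at pc) c
    good-instruction b nothing eq (here refl) cl cr g R sim =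
      outputs-halt eq (trans (sim (s≤s z≤n)) (trans (cl _) (trans (cong (λ i → b (M i)) (clip-toℕ zero)) (trans (sym (cr _)) g))))
    good-instruction {pc} {c} {c′} b (just (inc r)) eq (here refl) cl cr g R sim =
      outputs-inc eq (outputs-next {c = c′} eq g _ (simulates-update {c} {c′} sim (inc< {toℕ pc} eq)
        (trans (cr _) (cong₂ _+_ (δ-refl (M (clip r))) (sym (trans (sim (inc< {toℕ pc} eq)) (cl _)))))
        λ i≢ → trans (cr _) (trans (cong (_+ _) (δ-≢ λ e → i≢ (sym (M-injective e)))) (sym (cl _)))))
    good-instruction {pc} {c} {c′} b (just (decjz r j)) eq (here refl) cl cr g R sim =
      outputs-dec eq (trans (sim (dec< {toℕ pc} eq)) (trans (cl _) (cong (λ k → k + 0 + b (M (clip r))) (δ-refl (M (clip r))))))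
        (outputs-next {c = c′} eq g _ (simulates-update {c} {c′} sim (dec< {toℕ pc} eq) (cr _)
          λ i≢ → trans (cr _) (sym (trans (cl _) (cong (λ k → k + 0 + _) (δ-≢ λ e → i≢ (sym (M-injective e))))))))
    good-instruction b (just (decjz r j)) eq (there (here refl)) cl cr g R sim =
      let r≡0 , out = g eq R (λ j< → trans (sim j<) (trans (cl _) (sym (cr _))))
      in outputs-jump eq r≡0 out

    good-branch : ∀ {pc c c′ u q′ p} (b : Counters (4 + suc top)) mi → nth P (toℕ pc) ≡ mi →
                  (u , q′ , p) ∈ branch mi → All (λ i → c i ≡ 0) (tested mi) →
                  (∀ i → c i ≡ count i (fromMaybe u) + b i) → (∀ i → c′ i ≡ p i + b i) →
                  Good q′ c′ → Good (test pc) c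
    good-branch {pc} b (just (decjz r j)) eq (here refl) (r₀ ∷ []) cl cr g eq′ R sim
      with refl ← trans (sym eq) eq′ =
      trans (sim (dec< {toℕ pc} eq)) r₀ ,
      subst (λ k → Outputs0 P k R) (toℕ-clip (jump< {toℕ pc} eq)) (g R (λ j< → trans (sim j<) (trans (cl _) (sym (cr _)))))

    -- A premature loop exit still conserves `worth`; it is the zero test on leaving the next state
    -- that rules it out.
    good : ∀ {q c} → Win q c → Good q c
    good (halted z) = z _
    good {take} (fire b (here refl) (t₀ ∷ []) cl cr w) =
      conserve take scaleH cl cr (take-scaleH (b A) _ (b V) _ (trans (sym (cl T)) t₀)) (good w)
    good {take} (fire b (there (here refl)) (t₀ ∷ []) cl cr w) =
      conserve take power cl cr (take-power (b A) _ (b V) _ (trans (sym (cl T)) t₀)) (good w)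
    good {scaleH} (fire b (here refl) _ cl cr w) =
      conserve scaleH scaleH cl cr (scaleH-scaleH (b A) _ _ _ _) (good w)
    good {scaleH} (fire b (there (here refl)) _ cl cr w) = conserve scaleH scaledH cl cr refl (good w)
    good {scaledH} (fire b (here refl) (h₀ ∷ []) cl cr w) =
      conserve scaledH restoreH cl cr (scaledH-restoreH (b A) _ _ _ (trans (sym (cl H)) h₀)) (good w)
    good {restoreH} (fire b (here refl) _ cl cr w) =
      conserve restoreH restoreH cl cr (restoreH-restoreH (b A) _ _ _ _) (good w)
    good {restoreH} (fire b (there (here refl)) _ cl cr w) =
      conserve restoreH take cl cr (restoreH-take (b A) _ _ _ _) (good w)
    good {power} (fire b (here refl) (a₀ ∷ t₀ ∷ []) cl cr w) =
      conserve power scaleV cl cr (power-scaleV (b H) (b V) _ (trans (sym (cl A)) a₀) (trans (sym (cl T)) t₀)) (good w)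
    good {power} (fire b (there (here refl)) _ cl cr w) = conserve power move cl cr refl (good w)
    good {scaleV} (fire b (here refl) _ cl cr w) =
      conserve scaleV scaleV cl cr (scaleV-scaleV (b A) _ _ _ _) (good w)
    good {scaleV} (fire b (there (here refl)) _ cl cr w) = conserve scaleV scaledV cl cr refl (good w)
    good {scaledV} (fire b (here refl) (v₀ ∷ []) cl cr w) =
      conserve scaledV restoreV cl cr (scaledV-restoreV (b A) _ _ _ (trans (sym (cl V)) v₀)) (good w)
    good {restoreV} (fire b (here refl) _ cl cr w) =
      conserve restoreV restoreV cl cr (restoreV-restoreV (b A) _ _ _ _) (good w)
    good {restoreV} (fire b (there (here refl)) _ cl cr w) = conserve restoreV power cl cr refl (good w)
    good {move} (fire b (here refl) (a₀ ∷ h₀ ∷ t₀ ∷ []) cl cr w) =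
      conserve move move cl cr
        (move-move (b V) _ (trans (sym (cl A)) a₀) (trans (sym (cl H)) h₀) (trans (sym (cl T)) t₀)) (good w)
    good {move} (fire b (there (here refl)) (a₀ ∷ h₀ ∷ t₀ ∷ []) cl cr w) =
      conserve move start cl cr
        (move-start (b V) _ (trans (sym (cl A)) a₀) (trans (sym (cl H)) h₀) (trans (sym (cl T)) t₀)) (good w)
    good {start} (fire b (here refl) en cl cr w) =
      good-start en λ R sim → good w R λ j< → trans (sim j<) (trans (cl _) (sym (cr _)))
    good {clear} (fire b _ (x₀ ∷ []) cl cr w) = x₀
    good {at pc} (fire b tr _ cl cr w) = good-instruction b (nth P (toℕ pc)) refl tr cl cr (good w)
    good {test pc} (fire b tr en cl cr w) = good-branch b (nth P (toℕ pc)) refl tr en cl cr (good w)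

    -- Completeness: output 0 yields a winning run

    Delivers : ℕ → Set
    Delivers e = Win (at zero) (counters 0 0 0 0 e)

    win-start : ∀ {e} → Delivers e → Win start (counters 0 0 0 0 e)
    win-start {e} = fire (counters 0 0 0 0 e) (here refl)
      (refl ∷ refl ∷ refl ∷ refl ∷ All.map⁺ (All.tabulate λ _ → refl)) (λ _ → refl) (λ _ → refl)

    win-move : ∀ v x → Delivers (worth move 0 0 0 v x) → Win move (counters 0 0 0 v x)
    win-move zero x w = fire (counters 0 0 0 0 x) (there (here refl)) (refl ∷ refl ∷ refl ∷ [])
      (λ _ → refl) (byRegister refl refl refl refl refl λ _ → refl)
      (win-start (subst Delivers (trans (move-start 0 x refl refl refl) (+-identityʳ _)) w))
    win-move (suc v) x w = fire (counters 0 0 0 v x) (here refl) (refl ∷ refl ∷ refl ∷ [])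
      (byRegister refl refl refl refl refl λ _ → refl) (byRegister refl refl refl refl refl λ _ → refl)
      (win-move v (suc x) (subst Delivers (move-move v x refl refl refl) w))

    -- The continuation accepts any `k` with an equation for it, so the arithmetic of the loop is
    -- done on numbers and not inside `Win`.
    win-restoreV : ∀ h t v x → (∀ {k} → k ≡ v + t → Win power (counters 0 h 0 k x)) → Win restoreV (counters 0 h t v x)
    win-restoreV h zero v x w = fire (counters 0 h 0 v x) (there (here refl)) []
      (λ _ → refl) (λ _ → refl) (w (sym (+-identityʳ v)))
    win-restoreV h (suc t) v x w = fire (counters 0 h t v x) (here refl) []
      (byRegister refl refl refl refl refl λ _ → refl) (byRegister refl refl refl refl refl λ _ → refl)
      (win-restoreV h t (suc v) x λ eq → w (trans eq (sym (+-suc v t))))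

    win-scaleV : ∀ h t v x → (∀ {k} → k ≡ K * v + t → Win restoreV (counters 0 h k 0 x)) → Win scaleV (counters 0 h t v x)
    win-scaleV h t zero x w = fire (counters 0 h t 0 x) (there (here refl)) [] (λ _ → refl) (λ _ → refl)
      (fire (counters 0 h t 0 x) (here refl) (refl ∷ []) (λ _ → refl) (λ _ → refl) (w (cong (_+ t) (sym (*-zeroʳ K)))))
    win-scaleV h t (suc v) x w = fire (counters 0 h t v x) (here refl) []
      (byRegister refl refl refl refl refl λ _ → refl) (byRegister refl refl refl refl refl λ _ → refl)
      (win-scaleV h (K + t) v x λ eq → w (trans eq (lemma K v t)))
      where
      lemma : ∀ K v t → K * v + (K + t) ≡ K * (1 + v) + t
      lemma = solve-∀

    win-power : ∀ h v x → Delivers (worth power 0 h 0 v x) → Win power (counters 0 h 0 v x)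
    win-power zero v x w = fire (counters 0 0 0 v x) (there (here refl)) (refl ∷ refl ∷ [])
      (λ _ → refl) (λ _ → refl) (win-move v x w)
    win-power (suc h) v x w = fire (counters 0 h 0 v x) (here refl) (refl ∷ refl ∷ [])
      (byRegister refl refl refl refl refl λ _ → refl) (λ _ → refl)
      (win-scaleV h 0 v x λ { refl → win-restoreV h _ 0 x λ { refl → win-power h _ x
        (subst Delivers (trans (power-scaleV h v x refl refl)
          (cong (λ k → c₀ + (x + k * K ^ h)) (sym (+-identityʳ (K * v + 0))))) w) } })

    win-restoreH : ∀ a h t v x → (∀ {k} → k ≡ ν + (h + t) → Win take (counters a k 0 v x)) → Win restoreH (counters a h t v x)
    win-restoreH a h zero v x w = fire (counters a h 0 v x) (there (here refl)) []
      (λ _ → refl) (byRegister refl refl refl refl refl λ _ → refl) (w (cong (ν +_) (sym (+-identityʳ h))))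
    win-restoreH a h (suc t) v x w = fire (counters a h t v x) (here refl) []
      (byRegister refl refl refl refl refl λ _ → refl) (byRegister refl refl refl refl refl λ _ → refl)
      (win-restoreH a (suc h) t v x λ eq → w (trans eq (cong (ν +_) (sym (+-suc h t)))))

    win-scaleH : ∀ a h t v x → (∀ {k} → k ≡ μ * h + t → Win restoreH (counters a 0 k v x)) → Win scaleH (counters a h t v x)
    win-scaleH a zero t v x w = fire (counters a 0 t v x) (there (here refl)) [] (λ _ → refl) (λ _ → refl)
      (fire (counters a 0 t v x) (here refl) (refl ∷ []) (λ _ → refl) (λ _ → refl) (w (cong (_+ t) (sym (*-zeroʳ μ)))))
    win-scaleH a (suc h) t v x w = fire (counters a h t v x) (here refl) []
      (byRegister refl refl refl refl refl λ _ → refl) (byRegister refl refl refl refl refl λ _ → refl)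
      (win-scaleH a h (μ + t) v x λ eq → w (trans eq (lemma μ h t)))
      where
      lemma : ∀ μ h t → μ * h + (μ + t) ≡ μ * (1 + h) + t
      lemma = solve-∀

    win-take : ∀ a h v x → Delivers (c₀ + total a h v x) → Win take (counters a h 0 v x)
    win-take zero h v x w = fire (counters 0 h 0 v x) (there (here refl)) (refl ∷ []) (λ _ → refl) (λ _ → refl)
      (win-power h v x (subst Delivers (cong (λ k → c₀ + (x + k * K ^ h)) (sym (+-identityʳ v))) w))
    win-take (suc a) h v x w = fire (counters a h 0 v x) (here refl) (refl ∷ [])
      (byRegister refl refl refl refl refl λ _ → refl) (byRegister refl refl refl refl refl λ _ → refl)
      (win-scaleH a h 0 (c₂ + v) (c₁ + x) λ { refl → win-restoreH a 0 _ (c₂ + v) (c₁ + x) λ { refl →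
        win-take a _ (c₂ + v) (c₁ + x)
          (subst (λ k → Delivers (c₀ + total a (ν + k) (c₂ + v) (c₁ + x))) (sym (+-identityʳ (μ * h))) w) } })

    win-clear : ∀ is {c} → (∀ i → c i ≡ count i is) → c (M zero) ≡ 0 → Win clear c
    win-clear []       eq x₀ = halted eq
    win-clear (i ∷ is) eq x₀ = fire (λ j → count j is) (∈-map⁺ _ (∈-allFin i)) (x₀ ∷ [])
      (λ j → trans (eq j) (cong (_+ count j is) (sym (+-identityʳ (δ i j))))) (λ _ → refl)
      (win-clear is (λ _ → refl) (m+n≡0⇒n≡0 (δ i (M zero)) (trans (sym (eq (M zero))) x₀)))

    win-at : ∀ {pc mi t} → pc < suc top → nth P pc ≡ mi → t ∈ instruction (clip pc) mi → t ∈ out (at (clip pc))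
    win-at {pc} pc< refl = subst (λ k → _ ∈ instruction (clip pc) (nth P k)) (sym (toℕ-clip pc<))

    win-run : ∀ fuel {pc R c d} → pc < suc top → Simulates c R → run P fuel (pc , R) ≡ just d → proj₂ d 0 ≡ 0 →
              Win (at (clip pc)) c
    win-run (suc fuel) {pc} {R} {c} pc< sim runs d₀ with nth P pc in eq
    win-run (suc fuel) {pc} {R} {c} pc< sim refl d₀ | nothing =
      fire c (win-at pc< eq (here refl)) [] (λ _ → refl) (λ _ → refl)
        -- `spell c` lists the letters still present, in the order in which they are erased.
        (win-clear (spell c) (λ i → sym (count-spell c i))
          (trans (cong (λ i → c (M i)) (sym (clip-toℕ zero))) (trans (sym (sim (s≤s z≤n))) d₀)))
    win-run (suc fuel) {pc} {R} {c} pc< sim runs d₀ | just (inc r) =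
      fire c (win-at pc< eq (here refl)) [] (λ _ → refl) (λ _ → refl)
        (subst (λ k → Win (at (clip (suc k))) c′) (sym (toℕ-clip pc<))
          (win-run fuel (next< eq) (simulates-update {c} {c′} sim (inc< {pc} eq)
            (cong₂ _+_ (δ-refl (M (clip r))) (sym (sim (inc< {pc} eq))))
            λ i≢ → cong (_+ _) (δ-≢ λ e → i≢ (sym (M-injective e)))) runs d₀))
      where
      c′ : Counters (4 + suc top)
      c′ i = δ (M (clip r)) i + c i
    win-run (suc fuel) {pc} {R} {c} pc< sim runs d₀ | just (decjz r j) with R r in eqr
    ... | zero =
      fire c (win-at pc< eq (there (here refl))) [] (λ _ → refl) (λ _ → refl)
        (fire {q = test (clip pc)} c (here′ (sym (toℕ-clip pc<)) eq) (enabled (sym (toℕ-clip pc<)) eq) (λ _ → refl) (λ _ → refl)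
          (win-run fuel (jump< eq) sim runs d₀))
      where
      here′ : ∀ {k} → pc ≡ k → nth P pc ≡ just (decjz r j) → (nothing , at (clip j) , none) ∈ branch (nth P k)
      here′ refl eq rewrite eq = here refl
      enabled : ∀ {k} → pc ≡ k → nth P pc ≡ just (decjz r j) → All (λ i → c i ≡ 0) (tested (nth P k))
      enabled refl eq rewrite eq = trans (sym (sim (dec< {pc} eq))) eqr ∷ []
    ... | suc v =
      fire c′ (win-at pc< eq (here refl)) [] c-split (λ _ → refl)
        (subst (λ k → Win (at (clip (suc k))) c′) (sym (toℕ-clip pc<))
          (win-run fuel (next< eq) (simulates-update {c} {c′} sim (dec< {pc} eq)
            (trans (cong (c (M (clip r)) ∸_) (δ-refl (M (clip r)))) (cong (_∸ 1) cr))
            λ i≢ → cong (c _ ∸_) (δ-≢ λ e → i≢ (sym (M-injective e)))) runs d₀))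
      where
      -- Truncation in the subtraction is harmless: the decremented register holds `suc v`.
      c′ : Counters (4 + suc top)
      c′ i = c i ∸ δ (M (clip r)) i
      cr : c (M (clip r)) ≡ suc v
      cr = trans (sym (sim (dec< {pc} eq))) eqr
      c-split : ∀ i → c i ≡ δ (M (clip r)) i + 0 + c′ i
      c-split i with M (clip r) ≟ᶠ i
      ... | yes refl rewrite cr = refl
      ... | no  _    = refl

    initial : ∀ ρ i → count i (replicate ρ A) ≡ counters ρ 0 0 0 0 i
    initial zero    = byRegister refl refl refl refl refl λ _ → refl
    initial (suc ρ) = byRegister (cong suc (initial ρ A)) (initial ρ H) (initial ρ T) (initial ρ V)
                        (initial ρ (M zero)) λ i → initial ρ (M (suc i))

    reach⇒outputs : ∀ ρ → Reach (instanceFrom take (replicate ρ A)) → Passes (c₀ + total ρ 0 0 0)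
    reach⇒outputs ρ s = good (Win-cong (λ i → sym (initial ρ i)) (reach⇒win take (replicate ρ A) s))

    outputs⇒reach : ∀ ρ → Passes (c₀ + total ρ 0 0 0) → Reach (instanceFrom take (replicate ρ A))
    outputs⇒reach ρ (fuel , d , runs , d₀) = win⇒reach take (replicate ρ A)
      (Win-cong (initial ρ) (win-take ρ 0 0 0
        (subst (λ pc → Win (at pc) (counters 0 0 0 0 (c₀ + total ρ 0 0 0))) (clip-toℕ zero) (win-run fuel (s≤s z≤n) sim runs d₀))))
      where
      sim : ∀ {e} → Simulates (counters 0 0 0 0 e) (initRegs e)
      sim {e} {zero}  _        = sym (cong (λ i → counters 0 0 0 0 e (M i)) (clip-toℕ zero))
      sim {e} {suc j} (s≤s j<) = sym (cong (λ i → counters 0 0 0 0 e (M i))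
        (toℕ-injective {j = suc (fromℕ< j<)} (trans (toℕ-clip (s≤s j<)) (cong suc (sym (toℕ-fromℕ< j<))))))

    -- Closed form of the loaded number

    height : (a h : ℕ) → ℕ
    height zero    h = h
    height (suc a) h = height a (ν + μ * h)

    -- The loader applies the affine map to the starting value, while the code of a word applies it
    -- outermost, for the first letter; iteration makes both agree.
    height-suc : ∀ a h → height a (ν + μ * h) ≡ ν + μ * height a h
    height-suc zero    h = refl
    height-suc (suc a) h = height-suc a (ν + μ * h)

    total-closed : ∀ a h v x → total a h v x ≡ x + a * c₁ + (v + a * c₂) * K ^ height a h
    total-closed zero    h v x = cong₂ (λ k l → k + l * K ^ h) (sym (+-identityʳ x)) (sym (+-identityʳ v))
    total-closed (suc a) h v x = trans (total-closed a (ν + μ * h) (c₂ + v) (c₁ + x))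
      (cong₂ (λ k l → k + l * K ^ height a (ν + μ * h)) (lemma c₁ x (a * c₁)) (lemma c₂ v (a * c₂)))
      where
      lemma : ∀ c x k → c + x + k ≡ x + (c + k)
      lemma = solve-∀

-- The instance that runs P on its own code

encRule : ∀ {n} → Hedge n × Hedge n → ℕ
encRule (ℓ , r) = pair (encHedge ℓ) (encHedge r)

encList-cong : ∀ {A : Set} {f g : A → ℕ} → (∀ x → f x ≡ g x) → ∀ xs → encList f xs ≡ encList g xs
encList-cong eq []       = refl
encList-cong eq (x ∷ xs) = cong₂ (λ a b → suc (pair a b)) (eq x) (encList-cong eq xs)

encInstance-unfold : ∀ {n k l r b q g t} (I : Instance) (L : HA n) rules c s ts tgt →
  I ≡ record { n = n ; L = L ; rules = rules ; src = c ⟨ (s ⟨ [] ⟩) ∷ ts ⟩ ; tgt = tgt } →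
  n ≡ k → encHA L ≡ l → encList encRule rules ≡ r → toℕ c ≡ b → encTerm (s ⟨ [] ⟩) ≡ q →
  encHedge ts ≡ g → encTerm tgt ≡ t →
  encInstance I ≡ pair k (pair l (pair r (pair (pair b (suc (pair q g))) t)))
encInstance-unfold {n} _ L rules c s ts tgt refl refl refl refl refl refl refl refl = cong
  (λ r → pair n (pair (encHA L) (pair r (pair (encTerm (c ⟨ (s ⟨ [] ⟩) ∷ ts ⟩)) (encTerm tgt)))))
  -- Passes from the anonymous rule coder inside `encInstance` to `encRule`.
  (encList-cong (λ _ → refl) rules)

-- The source term holds ρ = 2 ^ (code of the rules) in unary. The constants built
-- into the rules depend on the alphabet, the automaton and the target only, so
-- there is no circularity, and from ρ the loader recovers the code of the instance.
-- The codes involved are variables here, lest the type checker evaluate them.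
module SelfReference (P : Program) where

  open Reduction P

  module Codes (n l b q a τ : ℕ)
    (n-code : #letters ≡ n) (l-code : encHA language ≡ l) (b-code : toℕ (code root) ≡ b)
    (q-code : encTerm (leaf (st take)) ≡ q) (a-code : encTerm (leaf (reg A)) ≡ a)
    (τ-code : encTerm (tree [ st clear ]) ≡ τ) where

    -- With B = 2 ^ b and C = 2 ^ q, the source term has code B (3 + 2 C) + 4 B C g, where g is the
    -- code of its unary tail. `k₀` is the constant part, and the slope 4 B C is the exponent of 2
    -- in K.
    k₀ : ℕ
    k₀ = 2 ^ b * (3 + 2 * 2 ^ q)

    -- With E = 2 ^ n, F = 2 ^ l and S = 2 ^ (code of the source), the nested pairs expand to E (1 +
    -- 2 F) + ρ 4 E F + ρ 8 E F (1 + 2 τ) S, which gives c₀, c₁ and, as S = 2 ^ k₀ K ^ g, also c₂.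
    -- With G = 2 ^ a, one more letter `A` turns g into 1 + G (1 + 2 g), whence μ = 2 G and ν = 1 +
    -- G.
    open Loader (2 ^ n * (1 + 2 * 2 ^ l)) (4 * 2 ^ n * 2 ^ l) (8 * 2 ^ n * 2 ^ l * (1 + 2 * τ) * 2 ^ k₀)
                (2 ^ (4 * 2 ^ b * 2 ^ q)) (2 * 2 ^ a) (1 + 2 ^ a) public

    rulesCode : ℕ
    rulesCode = encList encRule rules

    ρ : ℕ
    ρ = 2 ^ rulesCode

    selfInstance : Instance
    selfInstance = instanceFrom take (replicate ρ A)

    loaded : ℕ
    loaded = 2 ^ n * (1 + 2 * 2 ^ l) + total ρ 0 0 0

    encHedge-unary : ∀ k → encHedge (word (map reg (replicate k A))) ≡ height k 0
    encHedge-unary zero    = refl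
    encHedge-unary (suc k) = trans (cong₂ (λ a g → suc (2 ^ a * suc (2 * g))) a-code (encHedge-unary k))
      (trans (lemma (2 ^ a) (height k 0)) (sym (height-suc k 0)))
      where
      lemma : ∀ G g → 1 + G * (1 + 2 * g) ≡ 1 + G + 2 * G * g
      lemma = solve-∀

    two^source : ∀ g → 2 ^ pair b (suc (pair q g)) ≡ 2 ^ k₀ * (2 ^ (4 * 2 ^ b * 2 ^ q)) ^ g
    two^source g = begin
      2 ^ (2 ^ b * suc (2 * suc (2 ^ q * suc (2 * g))))   ≡⟨ cong (2 ^_) (lemma (2 ^ b) (2 ^ q) g) ⟩
      2 ^ (k₀ + 4 * 2 ^ b * 2 ^ q * g)                    ≡⟨ ^-distribˡ-+-* 2 k₀ _ ⟩
      2 ^ k₀ * 2 ^ (4 * 2 ^ b * 2 ^ q * g)                ≡⟨ cong (2 ^ k₀ *_) (^-*-assoc 2 (4 * 2 ^ b * 2 ^ q) g) ⟨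
      2 ^ k₀ * (2 ^ (4 * 2 ^ b * 2 ^ q)) ^ g              ∎
      where
      open ≡-Reasoning
      lemma : ∀ B C g → B * (1 + 2 * (1 + C * (1 + 2 * g))) ≡ B * (3 + 2 * C) + 4 * B * C * g
      lemma = solve-∀

    pairs≡loaded : ∀ {g} → g ≡ height ρ 0 →
                   pair n (pair l (pair rulesCode (pair (pair b (suc (pair q g))) τ))) ≡ loaded
    pairs≡loaded {g} refl = begin
      2 ^ n * suc (2 * (2 ^ l * suc (2 * (ρ * suc (2 * (2 ^ pair b (suc (pair q g)) * suc (2 * τ)))))))
        ≡⟨ cong (λ s → 2 ^ n * suc (2 * (2 ^ l * suc (2 * (ρ * suc (2 * (s * suc (2 * τ)))))))) (two^source g) ⟩
      2 ^ n * suc (2 * (2 ^ l * suc (2 * (ρ * suc (2 * (2 ^ k₀ * (2 ^ (4 * 2 ^ b * 2 ^ q)) ^ g * suc (2 * τ)))))))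
        ≡⟨ lemma (2 ^ n) (2 ^ l) ρ (2 ^ k₀) ((2 ^ (4 * 2 ^ b * 2 ^ q)) ^ g) τ ⟩
      2 ^ n * (1 + 2 * 2 ^ l) +
        (ρ * (4 * 2 ^ n * 2 ^ l) + ρ * (8 * 2 ^ n * 2 ^ l * (1 + 2 * τ) * 2 ^ k₀) * (2 ^ (4 * 2 ^ b * 2 ^ q)) ^ g)
        ≡⟨ cong (2 ^ n * (1 + 2 * 2 ^ l) +_) (total-closed ρ 0 0 0) ⟨
      loaded ∎
      where
      open ≡-Reasoning
      lemma : ∀ E F ρ a k τ → E * (1 + 2 * (F * (1 + 2 * (ρ * (1 + 2 * (a * k * (1 + 2 * τ)))))))
              ≡ E * (1 + 2 * F) + (ρ * (4 * E * F) + ρ * (8 * E * F * (1 + 2 * τ) * a) * k)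
      lemma = solve-∀

    code≡loaded : encInstance selfInstance ≡ loaded
    code≡loaded = trans
      (encInstance-unfold selfInstance language rules (code root) (code (st take)) (word (map reg (replicate ρ A)))
        (tree [ st clear ]) refl n-code l-code refl b-code q-code (encHedge-unary ρ) τ-code)
      (pairs≡loaded refl)

    -- No case distinction on `Reach` is made. If the target were reachable, `P` would output 1 by
    -- assumption and 0 by soundness, against determinism; so it is unreachable, `P` outputs 0, and
    -- completeness makes it reachable.
    undecided : ¬ DecidesReach P
    undecided decides = unreachable (outputs⇒reach ρ (computes 0 (proj₂ (decides selfInstance) unreachable)))
      where
      computes : ∀ y → Computes P (encInstance selfInstance) y → Computes P loaded y
      computes y = subst (λ e → Computes P e y) code≡loaded

      unreachable : ¬ Reach selfInstance
      unreachable reach =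
        1+n≢0 (computes-unique P {loaded} (computes 1 (proj₁ (decides selfInstance) reach)) (reach⇒outputs ρ reach))

theorem4 : ¬ (Σ Program DecidesReach)
theorem4 (P , decides) = SelfReference.Codes.undecided P _ _ _ _ _ _ refl refl refl refl refl refl decides
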